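{- (Selection adequacy) For any program $M:\sigma$, if $\mathrm{Op}_s(M)=\langle r,V\rangle$ then $\mathcal S[\![M]\!](0)=\langle r,\mathcal S_p[\![V]\!]\rangle$, where $0$ is the constantly $0$ reward function $\mathcal S[\![\sigma]\!]\to R$. (That is, $\mathcal S[\![M]\!](0)=W(\mathcal S_p)(\mathrm{Op}_s(M))$.)
   Context: **Language.** Fix base types $b$, including $\mathtt{Bool}$ and $\mathtt{Rew}$; for each $b$ a set $\mathrm{Con}_b$ of constants $c:b$ (including $\mathtt{tt},\mathtt{ff}:\mathtt{Bool}$, $0:\mathtt{Rew}$); and function symbols $f:b_1\ldots b_m\to b$, including $=_b\,:b\,b\to\mathtt{Bool}$ for each $b$, $+:\mathtt{Rew}\,\mathtt{Rew}\to\mathtt{Rew}$ and $\le\,:\mathtt{Rew}\,\mathtt{Rew}\to\mathtt{Bool}$. Types: $\sigma::=b\mid\mathtt{Unit}\mid\sigma\times\sigma\mid\sigma\to\sigma$. Terms: $M::=x\mid c\mid f(M_1,\dots,M_m)\mid\mathtt{if}\,L\,\mathtt{then}\,M\,\mathtt{else}\,N\mid M\,\mathtt{or}\,N\mid N\cdot M\mid *\mid\langle M,N\rangle\mid\mathtt{fst}(M)\mid\mathtt{snd}(M)\mid\lambda x{:}\sigma.M\mid MN$, up to $\alpha$-equivalence, with standard simple typing; $M\,\mathtt{or}\,N:\sigma$ when $M,N:\sigma$, and $N\cdot M:\sigma$ when $N:\mathtt{Rew}$, $M:\sigma$. Programs are closed well-typed terms. Values (closed): $V::=c\mid *\mid\langle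 V,W\rangle\mid\lambda x{:}\sigma.M$; $\mathrm{Val}_\sigma$ is the set of values of type $\sigma$. Effect values: $E::=V\mid E_1\,\mathtt{or}\,E_2\mid c\cdot E$ ($c:\mathtt{Rew}$). **Ordinary operational semantics.** Evaluation contexts (closed): $\mathcal E::=[\,]\mid f(c_1,\dots,c_{k-1},\mathcal E,M_{k+1},\dots,M_m)\mid\mathtt{if}\,\mathcal E\,\mathtt{then}\,M\,\mathtt{else}\,N\mid\mathcal E\cdot M\mid\langle\mathcal E,N\rangle\mid\langle V,\mathcal E\rangle\mid\mathtt{fst}(\mathcal E)\mid\mathtt{snd}(\mathcal E)\mid\mathcal EN\mid(\lambda x{:}\sigma.M)\mathcal E$. Constants $\mathrm{val}_f(c_1,\dots,c_m):b$ are given for all $f$ and $c_i:b_i$, with $\mathrm{val}_{=_b}(c,c')=\mathtt{tt}$ if $c=c'$, else $\mathtt{ff}$. Steps $\mathcal E[Q]\to\mathcal E[Q']$ arise from: $f(c_1,\dots,c_m)\to\mathrm{val}_f(c_1,\dots,c_m)$; $\mathtt{if}\,\mathtt{tt}\,\mathtt{then}\,M\,\mathtt{else}\,N\to M$; $\mathtt{if}\,\mathtt{ff}\,\mathtt{then}\,M\,\mathtt{else}\,N\to N$; $\mathtt{fst}\langle V,W\rangle\to V$; $\mathtt{snd}\langle V,W\rangle\to W$; $(\lambda x{:}\sigma.M)V\to M[V/x]$. Evaluation is deterministic and terminating, and each program $M:\sigma$ has an effect value $\mathrm{Op}(M):\sigma$ determined by $\mathrm{Op}(V)=V$; $\mathrm{Op}(M)=\mathrm{Op}(M')$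 if $M\to M'$; $\mathrm{Op}(\mathcal E[M_1\,\mathtt{or}\,M_2])=\mathrm{Op}(\mathcal E[M_1])\,\mathtt{or}\,\mathrm{Op}(\mathcal E[M_2])$; $\mathrm{Op}(\mathcal E[c\cdot M_1])=c\cdot\mathrm{Op}(\mathcal E[M_1])$. **Rewards and interpretation.** $R$ is a set with a commutative monoid structure $(+,0)$ and a total order $\le$ such that $r\le s\iff r+t\le s+t$. Given are nonempty sets $[\![b]\!]$ with $[\![\mathtt{Bool}]\!]=\{0,1\}$, $[\![\mathtt{Rew}]\!]=R$; elements $[\![c]\!]\in[\![b]\!]$ for $c:b$ with $[\![\mathtt{tt}]\!]=1$, $[\![\mathtt{ff}]\!]=0$, $[\![0]\!]=0$, distinct constants of the same type having distinct denotations, and $[\![c]\!]\ne0$ for some $c:\mathtt{Rew}$; and functions $[\![f]\!]:[\![b_1]\!]\times\cdots\times[\![b_m]\!]\to[\![b]\!]$ with $[\![+]\!]$ and $[\![\le]\!]$ the addition and (characteristic function of the) order of $R$, and $[\![f]\!]([\![c_1]\!],\dots,[\![c_m]\!])=[\![\mathrm{val}_f(c_1,\dots,c_m)]\!]$. $W(X)=R\times X$ and $W(f)\langle r,x\rangle=\langle r,f(x)\rangle$. **Selection operational semantics.** Strategies: a value has the single strategy $*$; those of $E_1\,\mathtt{or}\,E_2$ are $1s$ ($s\in\mathrm{Str}(E_1)$) and $2s$ ($s\in\mathrm{Str}(E_2)$); those of $c\cdot E$ are those of $E$. Outcomes: $\mathrm{Out}(*,V)=\langle0,V\rangle$, $\mathrm{Out}(is,E_1\,\mathtt{or}\,E_2)=\mathrm{Out}(s,E_i)$,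 and $\mathrm{Out}(s,c\cdot E)=\langle[\![c]\!]+r,V\rangle$ if $\mathrm{Out}(s,E)=\langle r,V\rangle$. $\mathrm{Rew}(s,E)=\pi_1(\mathrm{Out}(s,E))$. Strategies are totally ordered: on $E_1\,\mathtt{or}\,E_2$ all $1s$ precede all $2s'$, each group ordered as in $E_1$, resp. $E_2$; on $c\cdot E$ as in $E$. $\mathrm{argmax}$ picks the least maximizing strategy. $\mathrm{Op}_s(M)=\mathrm{Out}(\mathrm{argmax}_{s\in\mathrm{Str}(\mathrm{Op}(M))}\mathrm{Rew}(s,\mathrm{Op}(M)),\mathrm{Op}(M))\in R\times\mathrm{Val}_\sigma$. **Denotational semantics.** $S(X)=(X\to R)\to R\times X$. For $F\in S(X)$, $\gamma:X\to R$ put $\mathbf R(F|\gamma)=r+\gamma(x)$ where $\langle r,x\rangle=F(\gamma)$. $S$ is a monad with $\eta(x)(\gamma)=\langle0,x\rangle$ and, for $f:X\to S(Y)$, $f^\dagger(F)(\gamma)=\langle r+s,y\rangle$ where $\langle r,x\rangle=F(\lambda x'.\,\mathbf R(f(x')|\gamma))$ and $\langle s,y\rangle=f(x)(\gamma)$. Operations: $(G_0\,\mathtt{or}\,G_1)(\gamma)=G_0(\gamma)$ if $\mathbf R(G_0|\gamma)\ge\mathbf R(G_1|\gamma)$, else $G_1(\gamma)$; $(r\cdot G)(\gamma)=\langle r+s,x\rangle$ where $\langle s,x\rangle=G(\gamma)$. Types: $\mathcal S[\![b]\!]=[\![b]\!]$, $\mathcal S[\![\mathtt{Unit}]\!]=\{*\}$,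 $\mathcal S[\![\sigma\times\tau]\!]=\mathcal S[\![\sigma]\!]\times\mathcal S[\![\tau]\!]$, $\mathcal S[\![\sigma\to\tau]\!]=\mathcal S[\![\sigma]\!]\to S(\mathcal S[\![\tau]\!])$. A term $\Gamma\vdash M:\sigma$ denotes $\mathcal S[\![M]\!]:\mathcal S[\![\Gamma]\!]\to S(\mathcal S[\![\sigma]\!])$ by the standard left-to-right call-by-value monadic semantics: variables, constants, $*$ and abstractions via $\eta$ ($\mathcal S[\![\lambda x{:}\sigma.M]\!](\rho)=\eta(a\mapsto\mathcal S[\![M]\!](\rho,a))$); pairs, projections, applications, function symbols and conditions of conditionals by sequencing arguments left to right with Kleisli extension; $\mathcal S[\![M\,\mathtt{or}\,N]\!](\rho)=\mathcal S[\![M]\!](\rho)\,\mathtt{or}\,\mathcal S[\![N]\!](\rho)$; $\mathcal S[\![N\cdot M]\!](\rho)=(r\mapsto r\cdot\mathcal S[\![M]\!](\rho))^\dagger(\mathcal S[\![N]\!](\rho))$. For programs $\mathcal S[\![M]\!]$ is regarded as an element of $S(\mathcal S[\![\sigma]\!])$. Values $V:\sigma$ have a pure semantics $\mathcal S_p[\![V]\!]\in\mathcal S[\![\sigma]\!]$: $\mathcal S_p[\![c]\!]=[\![c]\!]$, $\mathcal S_p[\![*]\!]=*$, $\mathcal S_p[\![\langle V,V'\rangle]\!]=\langle\mathcal S_p[\![V]\!],\mathcal S_p[\![V']\!]\rangle$, $\mathcal S_p[\![\lambda x{:}\tau.N]\!]=\mathcal S[\![x{:}\tau\vdash N]\!]$.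 -}

module Defs where

open import Level using (0ℓ)
open import Function using (_∘_; Injective)
open import Data.Bool using (Bool; true; false; if_then_else_)
open import Data.Unit using (⊤; tt)
open import Data.Product using (∃; ∃-syntax; _×_; _,_; proj₁; proj₂)
open import Data.Sum using (_⊎_; inj₁; inj₂; [_,_])
open import Data.Sum.Relation.Binary.LeftOrder using (_⊎-<_; ₁∼₂; ₁∼₁; ₂∼₂)
open import Data.List using (List; []; _∷_)
open import Data.List.Relation.Unary.All as All using (All; []; _∷_)
open import Data.List.Relation.Unary.Any using (here; there)
open import Data.List.Membership.Propositional using (_∈_)
open import Relation.Nullary using (yes; no; ⌊_⌋; contradiction)
open import Relation.Binary using (Rel; IsDecTotalOrder)
open import Relation.Binary.PropositionalEquality
  using (_≡_; _≢_; refl; sym; trans; cong; cong₂; subst)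
open import Algebra.Structures using (IsCommutativeMonoid)

data BaseType (B : Set) : Set where
  bool rew : BaseType B
  other    : B → BaseType B

record Signature : Set₁ where
  field
    OtherBase : Set

  Base : Set
  Base = BaseType OtherBase

  field
    Con   : Base → Set
    ttᶜ   : Con bool
    ffᶜ   : Con bool
    zeroᶜ : Con rew

    -- Fun (b₁ ∷ … ∷ bₘ ∷ []) b is the set of symbols f : b₁ … bₘ → b.
    Fun  : List Base → Base → Set
    eqᶠ  : ∀ b → Fun (b ∷ b ∷ []) bool
    addᶠ : Fun (rew ∷ rew ∷ []) rew
    leqᶠ : Fun (rew ∷ rew ∷ []) bool

    valᶠ       : ∀ {bs b} → Fun bs b → All Con bs → Con b
    valᶠ-eq-tt : ∀ {b} {c d : Con b} → c ≡ d → valᶠ (eqᶠ b) (c ∷ d ∷ []) ≡ ttᶜ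
    valᶠ-eq-ff : ∀ {b} {c d : Con b} → c ≢ d → valᶠ (eqᶠ b) (c ∷ d ∷ []) ≡ ffᶜ

-- The order is taken to be decidable: classically every order is, and here it
-- already follows from the existence of a Bool-valued characteristic function
-- of ≤, which interpretations are required to supply as the meaning of leqᶠ.
record Rewards : Set₁ where
  infixl 6 _+_
  infix  4 _≤_
  field
    R                   : Set
    _+_                 : R → R → R
    0#                  : R
    _≤_                 : Rel R 0ℓ
    isCommutativeMonoid : IsCommutativeMonoid _≡_ _+_ 0#
    isDecTotalOrder     : IsDecTotalOrder _≡_ _≤_
    +-mono-≤            : ∀ {r s} t → r ≤ s → r + t ≤ s + t
    +-cancel-≤          : ∀ {r s} t → r + t ≤ s + t → r ≤ s

  open IsDecTotalOrder isDecTotalOrder public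
    using (_≤?_) renaming (refl to ≤-refl; trans to ≤-trans; total to ≤-total)

module _ {B : Set} (R : Set) (⟦_⟧ᵒ : B → Set) where
  baseDen : BaseType B → Set
  baseDen bool      = Bool
  baseDen rew       = R
  baseDen (other b) = ⟦ b ⟧ᵒ

record Interpretation (𝕊 : Signature) (𝓡 : Rewards) : Set₁ where
  open Signature 𝕊
  open Rewards 𝓡
  field
    ⟦_⟧ᵒ     : OtherBase → Set
    nonempty : ∀ b → ⟦ b ⟧ᵒ

  ⟦_⟧ᵇ : Base → Set
  ⟦_⟧ᵇ = baseDen R ⟦_⟧ᵒ

  field
    ⟦_⟧ᶜ           : ∀ {b} → Con b → ⟦ b ⟧ᵇ
    ⟦ttᶜ⟧          : ⟦ ttᶜ ⟧ᶜ ≡ true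
    ⟦ffᶜ⟧          : ⟦ ffᶜ ⟧ᶜ ≡ false
    ⟦zeroᶜ⟧        : ⟦ zeroᶜ ⟧ᶜ ≡ 0#
    ⟦⟧ᶜ-injective  : ∀ {b} → Injective _≡_ _≡_ (⟦_⟧ᶜ {b})
    nonzero-reward : ∃[ c ] ⟦_⟧ᶜ {rew} c ≢ 0#

    ⟦_⟧ᶠ   : ∀ {bs b} → Fun bs b → All ⟦_⟧ᵇ bs → ⟦ b ⟧ᵇ
    ⟦addᶠ⟧ : ∀ r s → ⟦ addᶠ ⟧ᶠ (r ∷ s ∷ []) ≡ r + s
    ⟦leqᶠ⟧ : ∀ r s → ⟦ leqᶠ ⟧ᶠ (r ∷ s ∷ []) ≡ ⌊ r ≤? s ⌋
    ⟦valᶠ⟧ : ∀ {bs b} (f : Fun bs b) (cs : All Con bs) →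
             ⟦ f ⟧ᶠ (All.map ⟦_⟧ᶜ cs) ≡ ⟦ valᶠ f cs ⟧ᶜ

  tt≢ff : ttᶜ ≢ ffᶜ
  tt≢ff eq with trans (sym ⟦ttᶜ⟧) (trans (cong ⟦_⟧ᶜ eq) ⟦ffᶜ⟧)
  ... | ()

  bool-canonical : (c : Con bool) → c ≡ ttᶜ ⊎ c ≡ ffᶜ
  bool-canonical c with ⟦ c ⟧ᶜ in eq
  ... | true  = inj₁ (⟦⟧ᶜ-injective (trans eq (sym ⟦ttᶜ⟧)))
  ... | false = inj₂ (⟦⟧ᶜ-injective (trans eq (sym ⟦ffᶜ⟧)))

module Language (𝕊 : Signature) where
  open Signature 𝕊 public

  infixr 7 _⇒_
  infixr 8 _⊗_

  data Ty : Set where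
    base : Base → Ty
    unit : Ty
    _⊗_  : Ty → Ty → Ty
    _⇒_  : Ty → Ty → Ty

  Cx : Set
  Cx = List Ty

  infixr 5 _or_
  infixr 6 _·_

  -- Intrinsically typed de Bruijn terms, i.e. terms up to α-equivalence.
  data Tm (Γ : Cx) : Ty → Set where
    var  : ∀ {σ} → σ ∈ Γ → Tm Γ σ
    con  : ∀ {b} → Con b → Tm Γ (base b)
    fn   : ∀ {bs b} → Fun bs b → All (λ b′ → Tm Γ (base b′)) bs → Tm Γ (base b)
    cond : ∀ {σ} → Tm Γ (base bool) → Tm Γ σ → Tm Γ σ → Tm Γ σ
    _or_ : ∀ {σ} → Tm Γ σ → Tm Γ σ → Tm Γ σ
    _·_  : ∀ {σ} → Tm Γ (base rew) → Tm Γ σ → Tm Γ σ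
    ∗    : Tm Γ unit
    pair : ∀ {σ τ} → Tm Γ σ → Tm Γ τ → Tm Γ (σ ⊗ τ)
    fst  : ∀ {σ τ} → Tm Γ (σ ⊗ τ) → Tm Γ σ
    snd  : ∀ {σ τ} → Tm Γ (σ ⊗ τ) → Tm Γ τ
    lam  : ∀ {σ τ} → Tm (σ ∷ Γ) τ → Tm Γ (σ ⇒ τ)
    app  : ∀ {σ τ} → Tm Γ (σ ⇒ τ) → Tm Γ σ → Tm Γ τ

  Tms : Cx → List Base → Set
  Tms Γ = All (λ b → Tm Γ (base b))

  Prog : Ty → Set
  Prog = Tm []

  Ren : Cx → Cx → Set
  Ren Γ Δ = ∀ {σ} → σ ∈ Γ → σ ∈ Δ

  Sub : Cx → Cx → Set
  Sub Γ Δ = ∀ {σ} → σ ∈ Γ → Tm Δ σ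

  ext : ∀ {Γ Δ τ} → Ren Γ Δ → Ren (τ ∷ Γ) (τ ∷ Δ)
  ext ρ (here eq) = here eq
  ext ρ (there x) = there (ρ x)

  ren  : ∀ {Γ Δ σ} → Ren Γ Δ → Tm Γ σ → Tm Δ σ
  rens : ∀ {Γ Δ bs} → Ren Γ Δ → Tms Γ bs → Tms Δ bs
  ren ρ (var x)      = var (ρ x)
  ren ρ (con c)      = con c
  ren ρ (fn f Ms)    = fn f (rens ρ Ms)
  ren ρ (cond L M N) = cond (ren ρ L) (ren ρ M) (ren ρ N)
  ren ρ (M or N)     = ren ρ M or ren ρ N
  ren ρ (N · M)      = ren ρ N · ren ρ M
  ren ρ ∗            = ∗
  ren ρ (pair M N)   = pair (ren ρ M) (ren ρ N)
  ren ρ (fst M)      = fst (ren ρ M)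
  ren ρ (snd M)      = snd (ren ρ M)
  ren ρ (lam M)      = lam (ren (ext ρ) M)
  ren ρ (app M N)    = app (ren ρ M) (ren ρ N)
  rens ρ []          = []
  rens ρ (M ∷ Ms)    = ren ρ M ∷ rens ρ Ms

  exts : ∀ {Γ Δ τ} → Sub Γ Δ → Sub (τ ∷ Γ) (τ ∷ Δ)
  exts θ (here eq) = var (here eq)
  exts θ (there x) = ren there (θ x)

  sub  : ∀ {Γ Δ σ} → Sub Γ Δ → Tm Γ σ → Tm Δ σ
  subs : ∀ {Γ Δ bs} → Sub Γ Δ → Tms Γ bs → Tms Δ bs
  sub θ (var x)      = θ x
  sub θ (con c)      = con c
  sub θ (fn f Ms)    = fn f (subs θ Ms)
  sub θ (cond L M N) = cond (sub θ L) (sub θ M) (sub θ N)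
  sub θ (M or N)     = sub θ M or sub θ N
  sub θ (N · M)      = sub θ N · sub θ M
  sub θ ∗            = ∗
  sub θ (pair M N)   = pair (sub θ M) (sub θ N)
  sub θ (fst M)      = fst (sub θ M)
  sub θ (snd M)      = snd (sub θ M)
  sub θ (lam M)      = lam (sub (exts θ) M)
  sub θ (app M N)    = app (sub θ M) (sub θ N)
  subs θ []          = []
  subs θ (M ∷ Ms)    = sub θ M ∷ subs θ Ms

  single : ∀ {Γ σ} → Tm Γ σ → Sub (σ ∷ Γ) Γ
  single N (here refl) = N
  single N (there x)   = var x

  _[_] : ∀ {Γ σ τ} → Tm (σ ∷ Γ) τ → Tm Γ σ → Tm Γ τ
  M [ N ] = sub (single N) M

  data Val : Ty → Set where
    con  : ∀ {b} → Con b → Val (base b)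
    ∗    : Val unit
    pair : ∀ {σ τ} → Val σ → Val τ → Val (σ ⊗ τ)
    lam  : ∀ {σ τ} → Tm (σ ∷ []) τ → Val (σ ⇒ τ)

  ⌜_⌝ : ∀ {σ} → Val σ → Prog σ
  ⌜ con c ⌝    = con c
  ⌜ ∗ ⌝        = ∗
  ⌜ pair V W ⌝ = pair ⌜ V ⌝ ⌜ W ⌝
  ⌜ lam M ⌝    = lam M

  cons : ∀ {bs} → All Con bs → Tms [] bs
  cons = All.map con

  data Eff (σ : Ty) : Set where
    val  : Val σ → Eff σ
    _or_ : Eff σ → Eff σ → Eff σ
    _·_  : Con rew → Eff σ → Eff σ

  -- ECtx ρ σ: evaluation contexts of type σ with a hole of type ρ.
  -- ECtxs ρ bs: argument lists c₁, …, cₖ₋₁, 𝓔, Mₖ₊₁, …, Mₘ of types bs.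
  data ECtx (ρ : Ty) : Ty → Set
  data ECtxs (ρ : Ty) : List Base → Set

  data ECtx ρ where
    □     : ECtx ρ ρ
    fn    : ∀ {bs b} → Fun bs b → ECtxs ρ bs → ECtx ρ (base b)
    cond  : ∀ {σ} → ECtx ρ (base bool) → Prog σ → Prog σ → ECtx ρ σ
    _·_   : ∀ {σ} → ECtx ρ (base rew) → Prog σ → ECtx ρ σ
    pairˡ : ∀ {σ τ} → ECtx ρ σ → Prog τ → ECtx ρ (σ ⊗ τ)
    pairʳ : ∀ {σ τ} → Val σ → ECtx ρ τ → ECtx ρ (σ ⊗ τ)
    fst   : ∀ {σ τ} → ECtx ρ (σ ⊗ τ) → ECtx ρ σ
    snd   : ∀ {σ τ} → ECtx ρ (σ ⊗ τ) → ECtx ρ τ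
    appˡ  : ∀ {σ τ} → ECtx ρ (σ ⇒ τ) → Prog σ → ECtx ρ τ
    appʳ  : ∀ {σ τ} → Tm (σ ∷ []) τ → ECtx ρ σ → ECtx ρ τ

  data ECtxs ρ where
    here  : ∀ {b bs} → ECtx ρ (base b) → Tms [] bs → ECtxs ρ (b ∷ bs)
    there : ∀ {b bs} → Con b → ECtxs ρ bs → ECtxs ρ (b ∷ bs)

  plug  : ∀ {ρ σ} → ECtx ρ σ → Prog ρ → Prog σ
  plugs : ∀ {ρ bs} → ECtxs ρ bs → Prog ρ → Tms [] bs
  plug □ Q            = Q
  plug (fn f C) Q     = fn f (plugs C Q)
  plug (cond C M N) Q = cond (plug C Q) M N
  plug (C · M) Q      = plug C Q · M
  plug (pairˡ C N) Q  = pair (plug C Q) N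
  plug (pairʳ V C) Q  = pair ⌜ V ⌝ (plug C Q)
  plug (fst C) Q      = fst (plug C Q)
  plug (snd C) Q      = snd (plug C Q)
  plug (appˡ C N) Q   = app (plug C Q) N
  plug (appʳ M C) Q   = app (lam M) (plug C Q)
  plugs (here C Ms) Q = plug C Q ∷ Ms
  plugs (there c C) Q = con c ∷ plugs C Q

  infix 4 _↝_ _⟶_ _⇓_

  data _↝_ : ∀ {σ} → Prog σ → Prog σ → Set where
    fn   : ∀ {bs b} (f : Fun bs b) (cs : All Con bs) → fn f (cons cs) ↝ con (valᶠ f cs)
    ifᵗ  : ∀ {σ} {M N : Prog σ} → cond (con ttᶜ) M N ↝ M
    ifᶠ  : ∀ {σ} {M N : Prog σ} → cond (con ffᶜ) M N ↝ N
    fst  : ∀ {σ τ} (V : Val σ) (W : Val τ) → fst (pair ⌜ V ⌝ ⌜ W ⌝) ↝ ⌜ V ⌝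
    snd  : ∀ {σ τ} (V : Val σ) (W : Val τ) → snd (pair ⌜ V ⌝ ⌜ W ⌝) ↝ ⌜ W ⌝
    beta : ∀ {σ τ} (M : Tm (σ ∷ []) τ) (V : Val σ) → app (lam M) ⌜ V ⌝ ↝ M [ ⌜ V ⌝ ]

  data _⟶_ {σ : Ty} : Prog σ → Prog σ → Set where
    step : ∀ {ρ} (C : ECtx ρ σ) {Q Q′} → Q ↝ Q′ → plug C Q ⟶ plug C Q′

  -- The clauses determining Op, with M ⇓ E for Op(M) = E.
  data _⇓_ {σ : Ty} : Prog σ → Eff σ → Set where
    value  : (V : Val σ) → ⌜ V ⌝ ⇓ val V
    reduce : ∀ {M M′ E} → M ⟶ M′ → M′ ⇓ E → M ⇓ E
    choose : ∀ {ρ} (C : ECtx ρ σ) {M₁ M₂ E₁ E₂} →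
             plug C M₁ ⇓ E₁ → plug C M₂ ⇓ E₂ → plug C (M₁ or M₂) ⇓ (E₁ or E₂)
    reward : ∀ {ρ} (C : ECtx ρ σ) c {M E} →
             plug C M ⇓ E → plug C (con c · M) ⇓ (c · E)

  private
    cong₃ : {A B C D : Set} (f : A → B → C → D) {a a′ : A} {b b′ : B} {c c′ : C} →
            a ≡ a′ → b ≡ b′ → c ≡ c′ → f a b c ≡ f a′ b′ c′
    cong₃ f refl refl refl = refl

  ext-ren : ∀ {Γ Δ Ξ υ} {ρ₁ : Ren Γ Δ} {ρ₂ : Ren Δ Ξ} {ρ₃ : Ren Γ Ξ} →
    (∀ {τ} (x : τ ∈ Γ) → ρ₂ (ρ₁ x) ≡ ρ₃ x) →
    ∀ {τ} (x : τ ∈ υ ∷ Γ) → ext ρ₂ (ext ρ₁ x) ≡ ext ρ₃ x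
  ext-ren h (here eq) = refl
  ext-ren h (there x) = cong there (h x)

  ren-ren  : ∀ {Γ Δ Ξ} {ρ₁ : Ren Γ Δ} {ρ₂ : Ren Δ Ξ} {ρ₃ : Ren Γ Ξ} →
    (∀ {τ} (x : τ ∈ Γ) → ρ₂ (ρ₁ x) ≡ ρ₃ x) →
    ∀ {σ} (M : Tm Γ σ) → ren ρ₂ (ren ρ₁ M) ≡ ren ρ₃ M
  ren-rens : ∀ {Γ Δ Ξ} {ρ₁ : Ren Γ Δ} {ρ₂ : Ren Δ Ξ} {ρ₃ : Ren Γ Ξ} →
    (∀ {τ} (x : τ ∈ Γ) → ρ₂ (ρ₁ x) ≡ ρ₃ x) →
    ∀ {bs} (Ms : Tms Γ bs) → rens ρ₂ (rens ρ₁ Ms) ≡ rens ρ₃ Ms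
  ren-ren h (var x)      = cong var (h x)
  ren-ren h (con c)      = refl
  ren-ren h (fn f Ms)    = cong (fn f) (ren-rens h Ms)
  ren-ren h (cond L M N) = cong₃ cond (ren-ren h L) (ren-ren h M) (ren-ren h N)
  ren-ren h (M or N)     = cong₂ _or_ (ren-ren h M) (ren-ren h N)
  ren-ren h (N · M)      = cong₂ _·_ (ren-ren h N) (ren-ren h M)
  ren-ren h ∗            = refl
  ren-ren h (pair M N)   = cong₂ pair (ren-ren h M) (ren-ren h N)
  ren-ren h (fst M)      = cong fst (ren-ren h M)
  ren-ren h (snd M)      = cong snd (ren-ren h M)
  ren-ren h (lam M)      = cong lam (ren-ren (ext-ren h) M)
  ren-ren h (app M N)    = cong₂ app (ren-ren h M) (ren-ren h N)
  ren-rens h []          = refl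
  ren-rens h (M ∷ Ms)    = cong₂ _∷_ (ren-ren h M) (ren-rens h Ms)

  exts-ext : ∀ {Γ Δ Ξ υ} {ρ : Ren Γ Δ} {θ : Sub Δ Ξ} {θ′ : Sub Γ Ξ} →
    (∀ {τ} (x : τ ∈ Γ) → θ (ρ x) ≡ θ′ x) →
    ∀ {τ} (x : τ ∈ υ ∷ Γ) → exts θ (ext ρ x) ≡ exts θ′ x
  exts-ext h (here eq) = refl
  exts-ext h (there x) = cong (ren there) (h x)

  sub-ren  : ∀ {Γ Δ Ξ} {ρ : Ren Γ Δ} {θ : Sub Δ Ξ} {θ′ : Sub Γ Ξ} →
    (∀ {τ} (x : τ ∈ Γ) → θ (ρ x) ≡ θ′ x) →
    ∀ {σ} (M : Tm Γ σ) → sub θ (ren ρ M) ≡ sub θ′ M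
  sub-rens : ∀ {Γ Δ Ξ} {ρ : Ren Γ Δ} {θ : Sub Δ Ξ} {θ′ : Sub Γ Ξ} →
    (∀ {τ} (x : τ ∈ Γ) → θ (ρ x) ≡ θ′ x) →
    ∀ {bs} (Ms : Tms Γ bs) → subs θ (rens ρ Ms) ≡ subs θ′ Ms
  sub-ren h (var x)      = h x
  sub-ren h (con c)      = refl
  sub-ren h (fn f Ms)    = cong (fn f) (sub-rens h Ms)
  sub-ren h (cond L M N) = cong₃ cond (sub-ren h L) (sub-ren h M) (sub-ren h N)
  sub-ren h (M or N)     = cong₂ _or_ (sub-ren h M) (sub-ren h N)
  sub-ren h (N · M)      = cong₂ _·_ (sub-ren h N) (sub-ren h M)
  sub-ren h ∗            = refl
  sub-ren h (pair M N)   = cong₂ pair (sub-ren h M) (sub-ren h N)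
  sub-ren h (fst M)      = cong fst (sub-ren h M)
  sub-ren h (snd M)      = cong snd (sub-ren h M)
  sub-ren h (lam M)      = cong lam (sub-ren (exts-ext h) M)
  sub-ren h (app M N)    = cong₂ app (sub-ren h M) (sub-ren h N)
  sub-rens h []          = refl
  sub-rens h (M ∷ Ms)    = cong₂ _∷_ (sub-ren h M) (sub-rens h Ms)

  ext-exts : ∀ {Γ Δ Ξ υ} {θ : Sub Γ Δ} {ρ : Ren Δ Ξ} {θ′ : Sub Γ Ξ} →
    (∀ {τ} (x : τ ∈ Γ) → ren ρ (θ x) ≡ θ′ x) →
    ∀ {τ} (x : τ ∈ υ ∷ Γ) → ren (ext ρ) (exts θ x) ≡ exts θ′ x
  ext-exts h (here eq) = refl
  ext-exts {θ = θ} h (there x) =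
    trans (ren-ren (λ _ → refl) (θ x))
          (trans (sym (ren-ren (λ _ → refl) (θ x))) (cong (ren there) (h x)))

  ren-sub  : ∀ {Γ Δ Ξ} {θ : Sub Γ Δ} {ρ : Ren Δ Ξ} {θ′ : Sub Γ Ξ} →
    (∀ {τ} (x : τ ∈ Γ) → ren ρ (θ x) ≡ θ′ x) →
    ∀ {σ} (M : Tm Γ σ) → ren ρ (sub θ M) ≡ sub θ′ M
  ren-subs : ∀ {Γ Δ Ξ} {θ : Sub Γ Δ} {ρ : Ren Δ Ξ} {θ′ : Sub Γ Ξ} →
    (∀ {τ} (x : τ ∈ Γ) → ren ρ (θ x) ≡ θ′ x) →
    ∀ {bs} (Ms : Tms Γ bs) → rens ρ (subs θ Ms) ≡ subs θ′ Ms
  ren-sub h (var x)      = h x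
  ren-sub h (con c)      = refl
  ren-sub h (fn f Ms)    = cong (fn f) (ren-subs h Ms)
  ren-sub h (cond L M N) = cong₃ cond (ren-sub h L) (ren-sub h M) (ren-sub h N)
  ren-sub h (M or N)     = cong₂ _or_ (ren-sub h M) (ren-sub h N)
  ren-sub h (N · M)      = cong₂ _·_ (ren-sub h N) (ren-sub h M)
  ren-sub h ∗            = refl
  ren-sub h (pair M N)   = cong₂ pair (ren-sub h M) (ren-sub h N)
  ren-sub h (fst M)      = cong fst (ren-sub h M)
  ren-sub h (snd M)      = cong snd (ren-sub h M)
  ren-sub h (lam M)      = cong lam (ren-sub (ext-exts h) M)
  ren-sub h (app M N)    = cong₂ app (ren-sub h M) (ren-sub h N)
  ren-subs h []          = refl
  ren-subs h (M ∷ Ms)    = cong₂ _∷_ (ren-sub h M) (ren-subs h Ms)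

  exts-exts : ∀ {Γ Δ Ξ υ} {θ₁ : Sub Γ Δ} {θ₂ : Sub Δ Ξ} {θ₃ : Sub Γ Ξ} →
    (∀ {τ} (x : τ ∈ Γ) → sub θ₂ (θ₁ x) ≡ θ₃ x) →
    ∀ {τ} (x : τ ∈ υ ∷ Γ) → sub (exts θ₂) (exts θ₁ x) ≡ exts θ₃ x
  exts-exts h (here eq) = refl
  exts-exts {θ₁ = θ₁} h (there x) =
    trans (sub-ren (λ _ → refl) (θ₁ x))
          (trans (sym (ren-sub (λ _ → refl) (θ₁ x))) (cong (ren there) (h x)))

  sub-sub  : ∀ {Γ Δ Ξ} {θ₁ : Sub Γ Δ} {θ₂ : Sub Δ Ξ} {θ₃ : Sub Γ Ξ} →
    (∀ {τ} (x : τ ∈ Γ) → sub θ₂ (θ₁ x) ≡ θ₃ x) →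
    ∀ {σ} (M : Tm Γ σ) → sub θ₂ (sub θ₁ M) ≡ sub θ₃ M
  sub-subs : ∀ {Γ Δ Ξ} {θ₁ : Sub Γ Δ} {θ₂ : Sub Δ Ξ} {θ₃ : Sub Γ Ξ} →
    (∀ {τ} (x : τ ∈ Γ) → sub θ₂ (θ₁ x) ≡ θ₃ x) →
    ∀ {bs} (Ms : Tms Γ bs) → subs θ₂ (subs θ₁ Ms) ≡ subs θ₃ Ms
  sub-sub h (var x)      = h x
  sub-sub h (con c)      = refl
  sub-sub h (fn f Ms)    = cong (fn f) (sub-subs h Ms)
  sub-sub h (cond L M N) = cong₃ cond (sub-sub h L) (sub-sub h M) (sub-sub h N)
  sub-sub h (M or N)     = cong₂ _or_ (sub-sub h M) (sub-sub h N)
  sub-sub h (N · M)      = cong₂ _·_ (sub-sub h N) (sub-sub h M)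
  sub-sub h ∗            = refl
  sub-sub h (pair M N)   = cong₂ pair (sub-sub h M) (sub-sub h N)
  sub-sub h (fst M)      = cong fst (sub-sub h M)
  sub-sub h (snd M)      = cong snd (sub-sub h M)
  sub-sub h (lam M)      = cong lam (sub-sub (exts-exts h) M)
  sub-sub h (app M N)    = cong₂ app (sub-sub h M) (sub-sub h N)
  sub-subs h []          = refl
  sub-subs h (M ∷ Ms)    = cong₂ _∷_ (sub-sub h M) (sub-subs h Ms)

  exts-var : ∀ {Γ υ} {θ : Sub Γ Γ} → (∀ {τ} (x : τ ∈ Γ) → θ x ≡ var x) →
    ∀ {τ} (x : τ ∈ υ ∷ Γ) → exts θ x ≡ var x
  exts-var h (here eq) = refl
  exts-var h (there x) = cong (ren there) (h x)

  sub-id  : ∀ {Γ} {θ : Sub Γ Γ} →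
    (∀ {τ} (x : τ ∈ Γ) → θ x ≡ var x) →
    ∀ {σ} (M : Tm Γ σ) → sub θ M ≡ M
  sub-ids : ∀ {Γ} {θ : Sub Γ Γ} →
    (∀ {τ} (x : τ ∈ Γ) → θ x ≡ var x) →
    ∀ {bs} (Ms : Tms Γ bs) → subs θ Ms ≡ Ms
  sub-id h (var x)      = h x
  sub-id h (con c)      = refl
  sub-id h (fn f Ms)    = cong (fn f) (sub-ids h Ms)
  sub-id h (cond L M N) = cong₃ cond (sub-id h L) (sub-id h M) (sub-id h N)
  sub-id h (M or N)     = cong₂ _or_ (sub-id h M) (sub-id h N)
  sub-id h (N · M)      = cong₂ _·_ (sub-id h N) (sub-id h M)
  sub-id h ∗            = refl
  sub-id h (pair M N)   = cong₂ pair (sub-id h M) (sub-id h N)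
  sub-id h (fst M)      = cong fst (sub-id h M)
  sub-id h (snd M)      = cong snd (sub-id h M)
  sub-id h (lam M)      = cong lam (sub-id (exts-var h) M)
  sub-id h (app M N)    = cong₂ app (sub-id h M) (sub-id h N)
  sub-ids h []          = refl
  sub-ids h (M ∷ Ms)    = cong₂ _∷_ (sub-id h M) (sub-ids h Ms)

  single-exts : ∀ {Γ σ τ} {θ : Sub Γ []} {θ′ : Sub (σ ∷ Γ) []} (M : Tm (σ ∷ Γ) τ) (N : Prog σ) →
    θ′ (here refl) ≡ N → (∀ {υ} (x : υ ∈ Γ) → θ′ (there x) ≡ θ x) →
    sub (exts θ) M [ N ] ≡ sub θ′ M
  single-exts {θ = θ} {θ′} M N h t = sub-sub agree M
    where
    agree : ∀ {υ} (x : υ ∈ _) → sub (single N) (exts θ x) ≡ θ′ x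
    agree (here refl) = sym h
    agree (there x)   =
      trans (sub-ren (λ _ → refl) (θ x)) (trans (sub-id (λ ()) (θ x)) (sym (t x)))

  _∘ᶜ_  : ∀ {ρ σ τ} → ECtx σ τ → ECtx ρ σ → ECtx ρ τ
  _∘ᶜˢ_ : ∀ {ρ σ bs} → ECtxs σ bs → ECtx ρ σ → ECtxs ρ bs
  □          ∘ᶜ D  = D
  fn f C     ∘ᶜ D  = fn f (C ∘ᶜˢ D)
  cond C M N ∘ᶜ D  = cond (C ∘ᶜ D) M N
  (C · M)    ∘ᶜ D  = (C ∘ᶜ D) · M
  pairˡ C N  ∘ᶜ D  = pairˡ (C ∘ᶜ D) N
  pairʳ V C  ∘ᶜ D  = pairʳ V (C ∘ᶜ D)
  fst C      ∘ᶜ D  = fst (C ∘ᶜ D)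
  snd C      ∘ᶜ D  = snd (C ∘ᶜ D)
  appˡ C N   ∘ᶜ D  = appˡ (C ∘ᶜ D) N
  appʳ M C   ∘ᶜ D  = appʳ M (C ∘ᶜ D)
  here C Ms  ∘ᶜˢ D = here (C ∘ᶜ D) Ms
  there c C  ∘ᶜˢ D = there c (C ∘ᶜˢ D)

  plug-∘  : ∀ {ρ σ τ} (C : ECtx σ τ) (D : ECtx ρ σ) Q →
            plug (C ∘ᶜ D) Q ≡ plug C (plug D Q)
  plugs-∘ : ∀ {ρ σ bs} (C : ECtxs σ bs) (D : ECtx ρ σ) Q →
            plugs (C ∘ᶜˢ D) Q ≡ plugs C (plug D Q)
  plug-∘ □ D Q            = refl
  plug-∘ (fn f C) D Q     = cong (fn f) (plugs-∘ C D Q)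
  plug-∘ (cond C M N) D Q = cong (λ L → cond L M N) (plug-∘ C D Q)
  plug-∘ (C · M) D Q      = cong (_· M) (plug-∘ C D Q)
  plug-∘ (pairˡ C N) D Q  = cong (λ M → pair M N) (plug-∘ C D Q)
  plug-∘ (pairʳ V C) D Q  = cong (pair ⌜ V ⌝) (plug-∘ C D Q)
  plug-∘ (fst C) D Q      = cong fst (plug-∘ C D Q)
  plug-∘ (snd C) D Q      = cong snd (plug-∘ C D Q)
  plug-∘ (appˡ C N) D Q   = cong (λ M → app M N) (plug-∘ C D Q)
  plug-∘ (appʳ M C) D Q   = cong (app (lam M)) (plug-∘ C D Q)
  plugs-∘ (here C Ms) D Q = cong (_∷ Ms) (plug-∘ C D Q)
  plugs-∘ (there c C) D Q = cong (con c ∷_) (plugs-∘ C D Q)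

  -- The terms that can stand in the hole of the context being evaluated:
  -- redexes, choices and rewards.
  data Active : Ty → Set where
    fn   : ∀ {bs b} → Fun bs b → All Con bs → Active (base b)
    cond : ∀ {σ} → Con bool → Prog σ → Prog σ → Active σ
    fst  : ∀ {σ τ} → Val σ → Val τ → Active σ
    snd  : ∀ {σ τ} → Val σ → Val τ → Active τ
    app  : ∀ {σ τ} → Tm (σ ∷ []) τ → Val σ → Active τ
    _or_ : ∀ {σ} → Prog σ → Prog σ → Active σ
    _·_  : ∀ {σ} → Con rew → Prog σ → Active σ

  ⌞_⌟ : ∀ {σ} → Active σ → Prog σ
  ⌞ fn f cs ⌟    = fn f (cons cs)
  ⌞ cond c M N ⌟ = cond (con c) M N
  ⌞ fst V W ⌟    = fst (pair ⌜ V ⌝ ⌜ W ⌝)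
  ⌞ snd V W ⌟    = snd (pair ⌜ V ⌝ ⌜ W ⌝)
  ⌞ app M V ⌟    = app (lam M) ⌜ V ⌝
  ⌞ M or N ⌟     = M or N
  ⌞ c · M ⌟      = con c · M

  Decomp : Ty → Set
  Decomp σ = Val σ ⊎ ∃ λ ρ → ECtx ρ σ × Active ρ

  Decomps : List Base → Set
  Decomps bs = All Con bs ⊎ ∃ λ ρ → ECtxs ρ bs × Active ρ

  decompose  : ∀ {σ} → Prog σ → Decomp σ
  decomposes : ∀ {bs} → Tms [] bs → Decomps bs
  decompose (con c) = inj₁ (con c)
  decompose (fn f Ms) with decomposes Ms
  ... | inj₁ cs            = inj₂ (_ , □ , fn f cs)
  ... | inj₂ (_ , C , Q)   = inj₂ (_ , fn f C , Q)
  decompose (cond L M N) with decompose L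
  ... | inj₁ (con c)       = inj₂ (_ , □ , cond c M N)
  ... | inj₂ (_ , C , Q)   = inj₂ (_ , cond C M N , Q)
  decompose (M or N) = inj₂ (_ , □ , (M or N))
  decompose (N · M) with decompose N
  ... | inj₁ (con c)       = inj₂ (_ , □ , (c · M))
  ... | inj₂ (_ , C , Q)   = inj₂ (_ , (C · M) , Q)
  decompose ∗ = inj₁ ∗
  decompose (pair M N) with decompose M
  ... | inj₂ (_ , C , Q)   = inj₂ (_ , pairˡ C N , Q)
  ... | inj₁ V with decompose N
  ...   | inj₂ (_ , C , Q) = inj₂ (_ , pairʳ V C , Q)
  ...   | inj₁ W           = inj₁ (pair V W)
  decompose (fst M) with decompose M
  ... | inj₁ (pair V W)    = inj₂ (_ , □ , fst V W)
  ... | inj₂ (_ , C , Q)   = inj₂ (_ , fst C , Q)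
  decompose (snd M) with decompose M
  ... | inj₁ (pair V W)    = inj₂ (_ , □ , snd V W)
  ... | inj₂ (_ , C , Q)   = inj₂ (_ , snd C , Q)
  decompose (lam M) = inj₁ (lam M)
  decompose (app M N) with decompose M
  ... | inj₂ (_ , C , Q)   = inj₂ (_ , appˡ C N , Q)
  ... | inj₁ (lam M′) with decompose N
  ...   | inj₂ (_ , C , Q) = inj₂ (_ , appʳ M′ C , Q)
  ...   | inj₁ V           = inj₂ (_ , □ , app M′ V)
  decomposes [] = inj₁ []
  decomposes (M ∷ Ms) with decompose M
  ... | inj₂ (_ , C , Q)   = inj₂ (_ , here C Ms , Q)
  ... | inj₁ (con c) with decomposes Ms
  ...   | inj₂ (_ , C , Q) = inj₂ (_ , there c C , Q)
  ...   | inj₁ cs          = inj₁ (c ∷ cs)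

  decompose-val : ∀ {σ} (V : Val σ) → decompose ⌜ V ⌝ ≡ inj₁ V
  decompose-val (con c)    = refl
  decompose-val ∗          = refl
  decompose-val (pair V W) rewrite decompose-val V | decompose-val W = refl
  decompose-val (lam M)    = refl

  decomposes-cons : ∀ {bs} (cs : All Con bs) → decomposes (cons cs) ≡ inj₁ cs
  decomposes-cons []       = refl
  decomposes-cons (c ∷ cs) rewrite decomposes-cons cs = refl

  decompose-active : ∀ {σ} (Q : Active σ) → decompose ⌞ Q ⌟ ≡ inj₂ (σ , □ , Q)
  decompose-active (fn f cs)    rewrite decomposes-cons cs = refl
  decompose-active (cond c M N) = refl
  decompose-active (fst V W)    rewrite decompose-val V | decompose-val W = refl
  decompose-active (snd V W)    rewrite decompose-val V | decompose-val W = refl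
  decompose-active (app M V)    rewrite decompose-val V = refl
  decompose-active (M or N)     = refl
  decompose-active (c · M)      = refl

  decompose-plug  : ∀ {ρ σ} (C : ECtx ρ σ) (Q : Active ρ) →
                    decompose (plug C ⌞ Q ⌟) ≡ inj₂ (ρ , C , Q)
  decomposes-plug : ∀ {ρ bs} (C : ECtxs ρ bs) (Q : Active ρ) →
                    decomposes (plugs C ⌞ Q ⌟) ≡ inj₂ (ρ , C , Q)
  decompose-plug □ Q            = decompose-active Q
  decompose-plug (fn f C) Q     rewrite decomposes-plug C Q = refl
  decompose-plug (cond C M N) Q rewrite decompose-plug C Q = refl
  decompose-plug (C · M) Q      rewrite decompose-plug C Q = refl
  decompose-plug (pairˡ C N) Q  rewrite decompose-plug C Q = refl
  decompose-plug (pairʳ V C) Q  rewrite decompose-val V | decompose-plug C Q = refl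
  decompose-plug (fst C) Q      rewrite decompose-plug C Q = refl
  decompose-plug (snd C) Q      rewrite decompose-plug C Q = refl
  decompose-plug (appˡ C N) Q   rewrite decompose-plug C Q = refl
  decompose-plug (appʳ M C) Q   rewrite decompose-plug C Q = refl
  decomposes-plug (here C Ms) Q rewrite decompose-plug C Q = refl
  decomposes-plug (there c C) Q rewrite decomposes-plug C Q = refl

module Semantics (𝕊 : Signature) (𝓡 : Rewards) (𝓘 : Interpretation 𝕊 𝓡) where
  open Language 𝕊 public
  open Rewards 𝓡 public
  open Interpretation 𝓘 public

  Inversion : ∀ {σ} → Decomp σ → Eff σ → Set
  Inversion (inj₁ V) E = E ≡ val V
  Inversion (inj₂ (_ , C , fn f cs)) E    = plug C (con (valᶠ f cs)) ⇓ E
  Inversion (inj₂ (_ , C , cond c M N)) E =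
    (c ≡ ttᶜ × plug C M ⇓ E) ⊎ (c ≡ ffᶜ × plug C N ⇓ E)
  Inversion (inj₂ (_ , C , fst V W)) E    = plug C ⌜ V ⌝ ⇓ E
  Inversion (inj₂ (_ , C , snd V W)) E    = plug C ⌜ W ⌝ ⇓ E
  Inversion (inj₂ (_ , C , app M V)) E    = plug C (M [ ⌜ V ⌝ ]) ⇓ E
  Inversion (inj₂ (_ , C , (M or N))) E   =
    ∃ λ E₁ → ∃ λ E₂ → E ≡ (E₁ or E₂) × plug C M ⇓ E₁ × plug C N ⇓ E₂
  Inversion (inj₂ (_ , C , (c · M))) E    = ∃ λ E₁ → E ≡ (c · E₁) × plug C M ⇓ E₁

  private
    at : ∀ {ρ σ} (C : ECtx ρ σ) (Q : Active ρ) {E} →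
         Inversion (inj₂ (ρ , C , Q)) E → Inversion (decompose (plug C ⌞ Q ⌟)) E
    at C Q {E} = subst (λ D → Inversion D E) (sym (decompose-plug C Q))

    from : ∀ {ρ σ} (C : ECtx ρ σ) (Q : Active ρ) {E} →
           Inversion (decompose (plug C ⌞ Q ⌟)) E → Inversion (inj₂ (ρ , C , Q)) E
    from C Q {E} = subst (λ D → Inversion D E) (decompose-plug C Q)

  invert : ∀ {σ} {M : Prog σ} {E} → M ⇓ E → Inversion (decompose M) E
  invert (value V) = subst (λ D → Inversion D (val V)) (sym (decompose-val V)) refl
  invert (reduce (step C (fn f cs)) d)        = at C (fn f cs) d
  invert (reduce (step C (ifᵗ {M = M} {N})) d) = at C (cond ttᶜ M N) (inj₁ (refl , d))
  invert (reduce (step C (ifᶠ {M = M} {N})) d) = at C (cond ffᶜ M N) (inj₂ (refl , d))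
  invert (reduce (step C (fst V W)) d)        = at C (fst V W) d
  invert (reduce (step C (snd V W)) d)        = at C (snd V W) d
  invert (reduce (step C (beta M V)) d)       = at C (app M V) d
  invert (choose C {M₁} {M₂} d₁ d₂)           = at C (M₁ or M₂) (_ , _ , refl , d₁ , d₂)
  invert (reward C c {M} d)                   = at C (c · M) (_ , refl , d)

  ⇓-unique : ∀ {σ} {M : Prog σ} {E E′} → M ⇓ E → M ⇓ E′ → E ≡ E′
  ⇓-unique {E′ = E′} (value V) e =
    sym (subst (λ D → Inversion D E′) (decompose-val V) (invert e))
  ⇓-unique (reduce (step C (fn f cs)) d) e  = ⇓-unique d (from C (fn f cs) (invert e))
  ⇓-unique (reduce (step C (ifᵗ {M = M} {N})) d) e
    with from C (cond ttᶜ M N) (invert e)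
  ... | inj₁ (_  , e′) = ⇓-unique d e′
  ... | inj₂ (eq , _)  = contradiction eq tt≢ff
  ⇓-unique (reduce (step C (ifᶠ {M = M} {N})) d) e
    with from C (cond ffᶜ M N) (invert e)
  ... | inj₁ (eq , _)  = contradiction (sym eq) tt≢ff
  ... | inj₂ (_  , e′) = ⇓-unique d e′
  ⇓-unique (reduce (step C (fst V W)) d) e  = ⇓-unique d (from C (fst V W) (invert e))
  ⇓-unique (reduce (step C (snd V W)) d) e  = ⇓-unique d (from C (snd V W) (invert e))
  ⇓-unique (reduce (step C (beta M V)) d) e = ⇓-unique d (from C (app M V) (invert e))
  ⇓-unique (choose C {M₁} {M₂} d₁ d₂) e with from C (M₁ or M₂) (invert e)
  ... | _ , _ , refl , e₁ , e₂ = cong₂ _or_ (⇓-unique d₁ e₁) (⇓-unique d₂ e₂)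
  ⇓-unique (reward C c {M} d) e with from C (c · M) (invert e)
  ... | _ , refl , e₁ = cong (c ·_) (⇓-unique d e₁)

  Leaves : ∀ {σ} → (Val σ → Set) → Eff σ → Set
  Leaves P (val V)    = P V
  Leaves P (E₁ or E₂) = Leaves P E₁ × Leaves P E₂
  Leaves P (c · E)    = Leaves P E

  Evaluates : ∀ {σ} → (Val σ → Set) → Prog σ → Set
  Evaluates P M = ∃ λ E → M ⇓ E × Leaves P E

  -- Tait-style reducibility, used to prove that evaluation terminates.
  Reducible : ∀ σ → Val σ → Set
  Reducible (base b) V          = ⊤
  Reducible unit V              = ⊤
  Reducible (σ ⊗ τ) (pair V W)  = Reducible σ V × Reducible τ W
  Reducible (σ ⇒ τ) (lam M)     =
    ∀ V → Reducible σ V → Evaluates (Reducible τ) (M [ ⌜ V ⌝ ])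

  reduce-eval : ∀ {ρ σ P} (C : ECtx ρ σ) {Q Q′} → Q ↝ Q′ →
                Evaluates P (plug C Q′) → Evaluates P (plug C Q)
  reduce-eval C s (E , d , l) = E , reduce (step C s) d , l

  bind : ∀ {ρ σ} {P : Val ρ → Set} {P′ : Val σ → Set} (C : ECtx ρ σ) {M} →
         Evaluates P M → (∀ V → P V → Evaluates P′ (plug C ⌜ V ⌝)) →
         Evaluates P′ (plug C M)
  bind {P = P} {P′} C (E , d , l) k = go d l
    where
    go : ∀ {M E} → M ⇓ E → Leaves P E → Evaluates P′ (plug C M)
    go (value V) l = k V l
    go (reduce (step D {Q} {Q′} s) d) l with go d l
    ... | E′ , e , m = E′ , subst (_⇓ E′) (plug-∘ C D Q)
                              (reduce (step (C ∘ᶜ D) s)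
                                (subst (_⇓ E′) (sym (plug-∘ C D Q′)) e)) , m
    go (choose D {M₁} {M₂} d₁ d₂) (l₁ , l₂) with go d₁ l₁ | go d₂ l₂
    ... | E₁ , e₁ , m₁ | E₂ , e₂ , m₂ =
      (E₁ or E₂) , subst (_⇓ (E₁ or E₂)) (plug-∘ C D (M₁ or M₂))
                     (choose (C ∘ᶜ D) (subst (_⇓ E₁) (sym (plug-∘ C D M₁)) e₁)
                                      (subst (_⇓ E₂) (sym (plug-∘ C D M₂)) e₂)) ,
      (m₁ , m₂)
    go (reward D c {M} d) l with go d l
    ... | E′ , e , m =
      (c · E′) , subst (_⇓ (c · E′)) (plug-∘ C D (con c · M))
                   (reward (C ∘ᶜ D) c (subst (_⇓ E′) (sym (plug-∘ C D M)) e)) , m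

  REnv : Cx → Set
  REnv = All (λ σ → ∃ (Reducible σ))

  closing : ∀ {Γ} → REnv Γ → Sub Γ []
  closing θ x = ⌜ proj₁ (All.lookup θ x) ⌝

  fundamental  : ∀ {Γ σ} (M : Tm Γ σ) (θ : REnv Γ) →
                 Evaluates (Reducible σ) (sub (closing θ) M)
  -- G Ms is a program whose evaluation proceeds by evaluating Ms left to right,
  -- F mapping contexts for the argument list to contexts for the program.
  fundamentals : ∀ {Γ σ bs} {P : Val σ → Set} (Ms : Tms Γ bs) (θ : REnv Γ)
                 (F : ∀ {ρ} → ECtxs ρ bs → ECtx ρ σ) (G : Tms [] bs → Prog σ) →
                 (∀ {ρ} (C : ECtxs ρ bs) Q → plug (F C) Q ≡ G (plugs C Q)) →
                 (∀ cs → Evaluates P (G (cons cs))) →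
                 Evaluates P (G (subs (closing θ) Ms))
  fundamental (var x) θ = val _ , value _ , proj₂ (All.lookup θ x)
  fundamental (con c) θ = val (con c) , value (con c) , tt
  fundamental (fn f Ms) θ =
    fundamentals Ms θ (fn f) (fn f) (λ _ _ → refl)
      (λ cs → reduce-eval □ (fn f cs) (val _ , value (con _) , tt))
  fundamental (cond L M N) θ =
    bind (cond □ _ _) (fundamental L θ)
      λ { (con c) _ → branch c (bool-canonical c) }
    where
    branch : ∀ c → c ≡ ttᶜ ⊎ c ≡ ffᶜ → Evaluates _ (cond (con c) _ _)
    branch c (inj₁ refl) = reduce-eval □ ifᵗ (fundamental M θ)
    branch c (inj₂ refl) = reduce-eval □ ifᶠ (fundamental N θ)
  fundamental (M or N) θ with fundamental M θ | fundamental N θ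
  ... | E₁ , d₁ , l₁ | E₂ , d₂ , l₂ = (E₁ or E₂) , choose □ d₁ d₂ , (l₁ , l₂)
  fundamental (N · M) θ =
    bind (□ · _) (fundamental N θ) λ { (con c) _ → act c (fundamental M θ) }
    where
    act : ∀ c → Evaluates _ (sub (closing θ) M) → Evaluates _ (con c · sub (closing θ) M)
    act c (E , d , l) = (c · E) , reward □ c d , l
  fundamental ∗ θ = val ∗ , value ∗ , tt
  fundamental (pair M N) θ =
    bind (pairˡ □ _) (fundamental M θ) λ V v →
    bind (pairʳ V □) (fundamental N θ) λ W w →
    val (pair V W) , value (pair V W) , (v , w)
  fundamental (fst M) θ =
    bind (fst □) (fundamental M θ)
      λ { (pair V W) (v , w) → reduce-eval □ (fst V W) (val V , value V , v) }
  fundamental (snd M) θ =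
    bind (snd □) (fundamental M θ)
      λ { (pair V W) (v , w) → reduce-eval □ (snd V W) (val W , value W , w) }
  fundamental (lam M) θ =
    val (lam _) , value (lam _) , λ V v →
      subst (Evaluates _) (sym (single-exts M ⌜ V ⌝ refl (λ _ → refl)))
        (fundamental M ((V , v) ∷ θ))
  fundamental (app M N) θ =
    bind (appˡ □ _) (fundamental M θ) λ { (lam L) l →
    bind (appʳ L □) (fundamental N θ) λ V v →
    reduce-eval □ (beta L V) (l V v) }
  fundamentals [] θ F G eq k = k []
  fundamentals {P = P} (M ∷ Ms) θ F G eq k =
    subst (Evaluates P) (eq (here □ Ms′) (sub (closing θ) M))
      (bind (F (here □ Ms′)) (fundamental M θ) λ { (con c) _ →
        subst (Evaluates P) (sym (eq (here □ Ms′) (con c)))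
          (fundamentals Ms θ (F ∘ there c) (G ∘ (con c ∷_))
            (λ C → eq (there c C)) (k ∘ (c ∷_))) })
    where Ms′ = subs (closing θ) Ms

  evaluate : ∀ {σ} (M : Prog σ) → ∃ λ E → M ⇓ E
  evaluate M with fundamental M []
  ... | E , d , _ = E , subst (_⇓ E) (sub-id (λ ()) M) d

  -- By Op-⇓ and Op-unique below, Op is the only function satisfying the clauses
  -- that define _⇓_.
  Op : ∀ {σ} → Prog σ → Eff σ
  Op M = proj₁ (evaluate M)

  Op-⇓ : ∀ {σ} (M : Prog σ) → M ⇓ Op M
  Op-⇓ M = proj₂ (evaluate M)

  Op-unique : ∀ {σ} {M : Prog σ} {E} → M ⇓ E → Op M ≡ E
  Op-unique d = ⇓-unique (Op-⇓ _) d

  -- The strategies 1s and 2s on a choice are inj₁ s and inj₂ s.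
  Str : ∀ {σ} → Eff σ → Set
  Str (val V)    = ⊤
  Str (E₁ or E₂) = Str E₁ ⊎ Str E₂
  Str (c · E)    = Str E

  Out : ∀ {σ} (E : Eff σ) → Str E → R × Val σ
  Out (val V)    _        = 0# , V
  Out (E₁ or E₂) (inj₁ s) = Out E₁ s
  Out (E₁ or E₂) (inj₂ s) = Out E₂ s
  Out (c · E)    s        = let (r , V) = Out E s in ⟦ c ⟧ᶜ + r , V

  Reward : ∀ {σ} (E : Eff σ) → Str E → R
  Reward E s = proj₁ (Out E s)

  -- The reflexive version of the total order on strategies.
  Precedes : ∀ {σ} (E : Eff σ) → Rel (Str E) 0ℓ
  Precedes (val V)    = _≡_
  Precedes (E₁ or E₂) = Precedes E₁ ⊎-< Precedes E₂
  Precedes (c · E)    = Precedes E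

  Maximizes : {A : Set} → (A → R) → A → Set
  Maximizes f s = ∀ t → f t ≤ f s

  IsArgmax : ∀ {σ} (E : Eff σ) → (Str E → R) → Str E → Set
  IsArgmax E f s = Maximizes f s × (∀ t → Maximizes f t → Precedes E s t)

  findArgmax : ∀ {σ} (E : Eff σ) (f : Str E → R) → ∃ (IsArgmax E f)
  findArgmax (val V) f = tt , (λ _ → ≤-refl) , (λ _ _ → refl)
  findArgmax (E₁ or E₂) f with findArgmax E₁ (f ∘ inj₁) | findArgmax E₂ (f ∘ inj₂)
  ... | s₁ , max₁ , least₁ | s₂ , max₂ , least₂ with f (inj₂ s₂) ≤? f (inj₁ s₁)
  ... | yes p = inj₁ s₁ ,
    [ max₁ , (λ t → ≤-trans (max₂ t) p) ] ,
    λ { (inj₁ t) m → ₁∼₁ (least₁ t (m ∘ inj₁)) ; (inj₂ t) m → ₁∼₂ }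
  ... | no ¬p = inj₂ s₂ ,
    [ (λ t → ≤-trans (max₁ t) s₁≤s₂) , max₂ ] ,
    λ { (inj₁ t) m → contradiction (≤-trans (m (inj₂ s₂)) (max₁ t)) ¬p
      ; (inj₂ t) m → ₂∼₂ (least₂ t (m ∘ inj₂)) }
    where
    s₁≤s₂ : f (inj₁ s₁) ≤ f (inj₂ s₂)
    s₁≤s₂ with ≤-total (f (inj₁ s₁)) (f (inj₂ s₂))
    ... | inj₁ q = q
    ... | inj₂ q = contradiction q ¬p
  findArgmax (c · E) f = findArgmax E f

  argmax : ∀ {σ} (E : Eff σ) → (Str E → R) → Str E
  argmax E f = proj₁ (findArgmax E f)

  Opₛ : ∀ {σ} → Prog σ → R × Val σ
  Opₛ M = Out (Op M) (argmax (Op M) (Reward (Op M)))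

  S : Set → Set
  S X = (X → R) → R × X

  module _ {X : Set} where
    𝐑 : S X → (X → R) → R
    𝐑 F γ = let (r , x) = F γ in r + γ x

    η : X → S X
    η x γ = 0# , x

    _orₛ_ : S X → S X → S X
    (G₀ orₛ G₁) γ = if ⌊ 𝐑 G₁ γ ≤? 𝐑 G₀ γ ⌋ then G₀ γ else G₁ γ

    _·ₛ_ : R → S X → S X
    (r ·ₛ G) γ = let (s , x) = G γ in r + s , x

  module _ {X Y : Set} where
    _† : (X → S Y) → S X → S Y
    (f †) F γ =
      let (r , x) = F (λ x′ → 𝐑 (f x′) γ)
          (s , y) = f x γ
      in r + s , y

    infixl 1 _>>=_
    _>>=_ : S X → (X → S Y) → S Y
    F >>= f = (f †) F

  -- Function types are interpreted by plain Agda functions, so identifying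
  -- denotations as in set theory takes function extensionality.
  𝒮ᵗ : Ty → Set
  𝒮ᵗ (base b) = ⟦ b ⟧ᵇ
  𝒮ᵗ unit     = ⊤
  𝒮ᵗ (σ ⊗ τ)  = 𝒮ᵗ σ × 𝒮ᵗ τ
  𝒮ᵗ (σ ⇒ τ)  = 𝒮ᵗ σ → S (𝒮ᵗ τ)

  Env : Cx → Set
  Env = All 𝒮ᵗ

  𝒮⟦_⟧  : ∀ {Γ σ} → Tm Γ σ → Env Γ → S (𝒮ᵗ σ)
  𝒮⟦_⟧ˢ : ∀ {Γ bs} → Tms Γ bs → Env Γ → S (All ⟦_⟧ᵇ bs)
  𝒮⟦ var x ⟧ ρ      = η (All.lookup ρ x)
  𝒮⟦ con c ⟧ ρ      = η ⟦ c ⟧ᶜ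
  𝒮⟦ fn f Ms ⟧ ρ    = 𝒮⟦ Ms ⟧ˢ ρ >>= λ as → η (⟦ f ⟧ᶠ as)
  𝒮⟦ cond L M N ⟧ ρ = 𝒮⟦ L ⟧ ρ >>= λ t → if t then 𝒮⟦ M ⟧ ρ else 𝒮⟦ N ⟧ ρ
  𝒮⟦ M or N ⟧ ρ     = 𝒮⟦ M ⟧ ρ orₛ 𝒮⟦ N ⟧ ρ
  𝒮⟦ N · M ⟧ ρ      = 𝒮⟦ N ⟧ ρ >>= λ r → r ·ₛ 𝒮⟦ M ⟧ ρ
  𝒮⟦ ∗ ⟧ ρ          = η tt
  𝒮⟦ pair M N ⟧ ρ   = 𝒮⟦ M ⟧ ρ >>= λ a → 𝒮⟦ N ⟧ ρ >>= λ b → η (a , b)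
  𝒮⟦ fst M ⟧ ρ      = 𝒮⟦ M ⟧ ρ >>= λ p → η (proj₁ p)
  𝒮⟦ snd M ⟧ ρ      = 𝒮⟦ M ⟧ ρ >>= λ p → η (proj₂ p)
  𝒮⟦ lam M ⟧ ρ      = η (λ a → 𝒮⟦ M ⟧ (a ∷ ρ))
  𝒮⟦ app M N ⟧ ρ    = 𝒮⟦ M ⟧ ρ >>= λ h → 𝒮⟦ N ⟧ ρ >>= λ a → h a
  𝒮⟦ [] ⟧ˢ ρ        = η []
  𝒮⟦ M ∷ Ms ⟧ˢ ρ    = 𝒮⟦ M ⟧ ρ >>= λ a → 𝒮⟦ Ms ⟧ˢ ρ >>= λ as → η (a ∷ as)

  𝒮ₚ⟦_⟧ : ∀ {σ} → Val σ → 𝒮ᵗ σ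
  𝒮ₚ⟦ con c ⟧    = ⟦ c ⟧ᶜ
  𝒮ₚ⟦ ∗ ⟧        = tt
  𝒮ₚ⟦ pair V W ⟧ = 𝒮ₚ⟦ V ⟧ , 𝒮ₚ⟦ W ⟧
  𝒮ₚ⟦ lam N ⟧    = λ a → 𝒮⟦ N ⟧ (a ∷ [])

{-# OPTIONS --safe #-}

-- Every evaluation context C denotes a Kleisli map: 𝒮⟦ plug C Q ⟧ is 𝒮⟦ Q ⟧
-- followed by a continuation determined by C. Since F ↦ F >>= f commutes with
-- choices and rewards, each clause of _⇓_ is an equation in the semantics, so
-- M and Op(M) have the same denotation. At the zero reward function, the
-- denotation of an effect value compares the two sides of each choice by their
-- best total rewards, resolving ties to the left, as argmax does.
module Submission where

open import Level using (0ℓ)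
open import Function using (_∘_; _⇔_; mk⇔; module Equivalence)
open import Data.Bool using (true; false; if_then_else_)
open import Data.Product using (_,_; proj₁; proj₂; map₂)
open import Data.Sum using (inj₁; inj₂)
open import Data.List using ([]; _∷_)
open import Data.List.Relation.Unary.All as All using (All; []; _∷_)
open import Data.List.Relation.Unary.Any using (here; there)
open import Data.List.Membership.Propositional using (_∈_)
open import Relation.Nullary using (yes; no; ⌊_⌋; contradiction)
open import Relation.Binary.PropositionalEquality
  using (_≡_; refl; sym; trans; cong; cong₂; subst₂)
open import Algebra.Structures using (IsCommutativeMonoid)
open import Axiom.Extensionality.Propositional using (Extensionality)
open import Defs

module Adequacy (funext : Extensionality 0ℓ 0ℓ)
                (𝕊 : Signature) (𝓡 : Rewards) (𝓘 : Interpretation 𝕊 𝓡) where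
  open Semantics 𝕊 𝓡 𝓘
  open IsCommutativeMonoid isCommutativeMonoid
    using (assoc; identityˡ; identityʳ; comm)

  -- Monad laws of `S`, and its operations under sequencing.

  module _ {X : Set} where
    𝐑-η : (x : X) (γ : X → R) → 𝐑 (η x) γ ≡ γ x
    𝐑-η x γ = identityˡ (γ x)

    -- Sequencing with `η` runs `F` at `λ x → 0# + γ x`, which equals `γ` only pointwise; hence a
    -- second use of extensionality inside the outer one.
    >>=-identityʳ : (F : S X) → (F >>= η) ≡ F
    >>=-identityʳ F = funext λ γ →
      trans (cong (λ γ′ → proj₁ (F γ′) + 0# , proj₂ (F γ′)) (funext λ x → 𝐑-η x γ))
            (cong (_, proj₂ (F γ)) (identityʳ (proj₁ (F γ))))

  module _ {X Y : Set} where
    >>=-cong : {F G : S X} {f g : X → S Y} →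
               F ≡ G → (∀ x → f x ≡ g x) → (F >>= f) ≡ (G >>= g)
    >>=-cong F≡G f≗g = cong₂ _>>=_ F≡G (funext f≗g)

    >>=-congˡ : {F G : S X} (f : X → S Y) → F ≡ G → (F >>= f) ≡ (G >>= f)
    >>=-congˡ f = cong (_>>= f)

    >>=-identityˡ : (x : X) (f : X → S Y) → (η x >>= f) ≡ f x
    >>=-identityˡ x f = funext λ γ → cong (_, proj₂ (f x γ)) (identityˡ (proj₁ (f x γ)))

    -- The selection function `F` is run at exactly the reward function on the right, so only the
    -- bracketing of one sum differs.
    𝐑->>= : (F : S X) (f : X → S Y) (γ : Y → R) →
            𝐑 (F >>= f) γ ≡ 𝐑 F (λ x → 𝐑 (f x) γ)
    𝐑->>= F f γ = assoc _ _ _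

    -- By `𝐑->>=`, choosing before or after the continuation compares the same two rewards, so the
    -- same side wins.
    orₛ->>= : (F G : S X) (f : X → S Y) → ((F orₛ G) >>= f) ≡ ((F >>= f) orₛ (G >>= f))
    orₛ->>= F G f = funext λ γ → pointwise γ
      where
      pointwise : ∀ γ → ((F orₛ G) >>= f) γ ≡ ((F >>= f) orₛ (G >>= f)) γ
      pointwise γ rewrite 𝐑->>= F f γ | 𝐑->>= G f γ
        with ⌊ 𝐑 G (λ x → 𝐑 (f x) γ) ≤? 𝐑 F (λ x → 𝐑 (f x) γ) ⌋
      ... | true  = refl
      ... | false = refl

    ·ₛ->>= : (r : R) (F : S X) (f : X → S Y) → ((r ·ₛ F) >>= f) ≡ (r ·ₛ (F >>= f))
    ·ₛ->>= r F f = funext λ γ → cong₂ _,_ (assoc r _ _) refl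

  -- Besides rebracketing the accumulated rewards, the two sides hand `F` reward functions that
  -- agree pointwise by `𝐑->>=`.
  >>=-assoc : {X Y Z : Set} (F : S X) (f : X → S Y) (g : Y → S Z) →
              (F >>= f >>= g) ≡ (F >>= λ x → f x >>= g)
  >>=-assoc F f g = funext λ γ →
    trans (cong₂ _,_ (assoc _ _ _) refl)
          (cong (λ γ′ → let (r , x) = F γ′
                            (s , z) = (f x >>= g) γ
                        in r + s , z)
                (funext λ x → sym (𝐑->>= (f x) g γ)))

  -- Renaming and substitution lemmas.

  lookup-ext : ∀ {Γ Δ υ} (ξ : Ren Γ Δ) (ρ : Env Γ) (ρ′ : Env Δ) →
    (∀ {τ} (x : τ ∈ Γ) → All.lookup ρ′ (ξ x) ≡ All.lookup ρ x) →
    ∀ (a : 𝒮ᵗ υ) {τ} (x : τ ∈ υ ∷ Γ) →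
    All.lookup (a ∷ ρ′) (ext ξ x) ≡ All.lookup (a ∷ ρ) x
  lookup-ext ξ ρ ρ′ h a (here refl) = refl
  lookup-ext ξ ρ ρ′ h a (there x)   = h x

  -- Comes before substitution because `exts` weakens the terms it carries under a binder.
  𝒮-ren  : ∀ {Γ Δ} (ξ : Ren Γ Δ) (ρ : Env Γ) (ρ′ : Env Δ) →
    (∀ {τ} (x : τ ∈ Γ) → All.lookup ρ′ (ξ x) ≡ All.lookup ρ x) →
    ∀ {σ} (M : Tm Γ σ) → 𝒮⟦ ren ξ M ⟧ ρ′ ≡ 𝒮⟦ M ⟧ ρ
  𝒮-rens : ∀ {Γ Δ} (ξ : Ren Γ Δ) (ρ : Env Γ) (ρ′ : Env Δ) →
    (∀ {τ} (x : τ ∈ Γ) → All.lookup ρ′ (ξ x) ≡ All.lookup ρ x) →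
    ∀ {bs} (Ms : Tms Γ bs) → 𝒮⟦ rens ξ Ms ⟧ˢ ρ′ ≡ 𝒮⟦ Ms ⟧ˢ ρ
  𝒮-ren ξ ρ ρ′ h (var x)      = cong η (h x)
  𝒮-ren ξ ρ ρ′ h (con c)      = refl
  𝒮-ren ξ ρ ρ′ h (fn f Ms)    = >>=-congˡ _ (𝒮-rens ξ ρ ρ′ h Ms)
  𝒮-ren ξ ρ ρ′ h (cond L M N) = >>=-cong (𝒮-ren ξ ρ ρ′ h L) λ
    { true → 𝒮-ren ξ ρ ρ′ h M ; false → 𝒮-ren ξ ρ ρ′ h N }
  𝒮-ren ξ ρ ρ′ h (M or N)     = cong₂ _orₛ_ (𝒮-ren ξ ρ ρ′ h M) (𝒮-ren ξ ρ ρ′ h N)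
  𝒮-ren ξ ρ ρ′ h (N · M)      = >>=-cong (𝒮-ren ξ ρ ρ′ h N) λ r →
    cong (r ·ₛ_) (𝒮-ren ξ ρ ρ′ h M)
  𝒮-ren ξ ρ ρ′ h ∗            = refl
  𝒮-ren ξ ρ ρ′ h (pair M N)   = >>=-cong (𝒮-ren ξ ρ ρ′ h M) λ a →
    >>=-congˡ _ (𝒮-ren ξ ρ ρ′ h N)
  𝒮-ren ξ ρ ρ′ h (fst M)      = >>=-congˡ _ (𝒮-ren ξ ρ ρ′ h M)
  𝒮-ren ξ ρ ρ′ h (snd M)      = >>=-congˡ _ (𝒮-ren ξ ρ ρ′ h M)
  𝒮-ren ξ ρ ρ′ h (lam M)      = cong η (funext λ a →
    𝒮-ren (ext ξ) (a ∷ ρ) (a ∷ ρ′) (lookup-ext ξ ρ ρ′ h a) M)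
  𝒮-ren ξ ρ ρ′ h (app M N)    = >>=-cong (𝒮-ren ξ ρ ρ′ h M) λ k →
    >>=-congˡ k (𝒮-ren ξ ρ ρ′ h N)
  𝒮-rens ξ ρ ρ′ h []          = refl
  𝒮-rens ξ ρ ρ′ h (M ∷ Ms)    = >>=-cong (𝒮-ren ξ ρ ρ′ h M) λ a →
    >>=-congˡ _ (𝒮-rens ξ ρ ρ′ h Ms)

  𝒮-exts : ∀ {Γ Δ υ} (θ : Sub Γ Δ) (ρ : Env Γ) (ρ′ : Env Δ) →
    (∀ {τ} (x : τ ∈ Γ) → 𝒮⟦ θ x ⟧ ρ′ ≡ η (All.lookup ρ x)) →
    ∀ (a : 𝒮ᵗ υ) {τ} (x : τ ∈ υ ∷ Γ) →
    𝒮⟦ exts θ x ⟧ (a ∷ ρ′) ≡ η (All.lookup (a ∷ ρ) x)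
  𝒮-exts θ ρ ρ′ h a (here refl) = refl
  𝒮-exts θ ρ ρ′ h a (there x)   = trans (𝒮-ren there ρ′ (a ∷ ρ′) (λ _ → refl) (θ x)) (h x)

  -- Variables denote via `η`, so the substituted terms must be pure as well; an effectful one would
  -- run again at each occurrence.
  𝒮-sub  : ∀ {Γ Δ} (θ : Sub Γ Δ) (ρ : Env Γ) (ρ′ : Env Δ) →
    (∀ {τ} (x : τ ∈ Γ) → 𝒮⟦ θ x ⟧ ρ′ ≡ η (All.lookup ρ x)) →
    ∀ {σ} (M : Tm Γ σ) → 𝒮⟦ sub θ M ⟧ ρ′ ≡ 𝒮⟦ M ⟧ ρ
  𝒮-subs : ∀ {Γ Δ} (θ : Sub Γ Δ) (ρ : Env Γ) (ρ′ : Env Δ) →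
    (∀ {τ} (x : τ ∈ Γ) → 𝒮⟦ θ x ⟧ ρ′ ≡ η (All.lookup ρ x)) →
    ∀ {bs} (Ms : Tms Γ bs) → 𝒮⟦ subs θ Ms ⟧ˢ ρ′ ≡ 𝒮⟦ Ms ⟧ˢ ρ
  𝒮-sub θ ρ ρ′ h (var x)      = h x
  𝒮-sub θ ρ ρ′ h (con c)      = refl
  𝒮-sub θ ρ ρ′ h (fn f Ms)    = >>=-congˡ _ (𝒮-subs θ ρ ρ′ h Ms)
  𝒮-sub θ ρ ρ′ h (cond L M N) = >>=-cong (𝒮-sub θ ρ ρ′ h L) λ
    { true → 𝒮-sub θ ρ ρ′ h M ; false → 𝒮-sub θ ρ ρ′ h N }
  𝒮-sub θ ρ ρ′ h (M or N)     = cong₂ _orₛ_ (𝒮-sub θ ρ ρ′ h M) (𝒮-sub θ ρ ρ′ h N)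
  𝒮-sub θ ρ ρ′ h (N · M)      = >>=-cong (𝒮-sub θ ρ ρ′ h N) λ r →
    cong (r ·ₛ_) (𝒮-sub θ ρ ρ′ h M)
  𝒮-sub θ ρ ρ′ h ∗            = refl
  𝒮-sub θ ρ ρ′ h (pair M N)   = >>=-cong (𝒮-sub θ ρ ρ′ h M) λ a →
    >>=-congˡ _ (𝒮-sub θ ρ ρ′ h N)
  𝒮-sub θ ρ ρ′ h (fst M)      = >>=-congˡ _ (𝒮-sub θ ρ ρ′ h M)
  𝒮-sub θ ρ ρ′ h (snd M)      = >>=-congˡ _ (𝒮-sub θ ρ ρ′ h M)
  𝒮-sub θ ρ ρ′ h (lam M)      = cong η (funext λ a →
    𝒮-sub (exts θ) (a ∷ ρ) (a ∷ ρ′) (𝒮-exts θ ρ ρ′ h a) M)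
  𝒮-sub θ ρ ρ′ h (app M N)    = >>=-cong (𝒮-sub θ ρ ρ′ h M) λ k →
    >>=-congˡ k (𝒮-sub θ ρ ρ′ h N)
  𝒮-subs θ ρ ρ′ h []          = refl
  𝒮-subs θ ρ ρ′ h (M ∷ Ms)    = >>=-cong (𝒮-sub θ ρ ρ′ h M) λ a →
    >>=-congˡ _ (𝒮-subs θ ρ ρ′ h Ms)

  -- Values, redexes and evaluation contexts.

  >>=-η : ∀ {X Y : Set} {F : S X} {x} → F ≡ η x → (f : X → S Y) → (F >>= f) ≡ f x
  >>=-η F≡ηx f = trans (>>=-congˡ f F≡ηx) (>>=-identityˡ _ f)

  𝒮-val : ∀ {σ} (V : Val σ) → 𝒮⟦ ⌜ V ⌝ ⟧ [] ≡ η 𝒮ₚ⟦ V ⟧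
  𝒮-val (con c)    = refl
  𝒮-val ∗          = refl
  𝒮-val (pair V W) = trans (>>=-η (𝒮-val V) λ a → 𝒮⟦ ⌜ W ⌝ ⟧ [] >>= λ b → η (a , b))
                           (>>=-η (𝒮-val W) λ b → η (𝒮ₚ⟦ V ⟧ , b))
  𝒮-val (lam M)    = refl

  𝒮-cons : ∀ {bs} (cs : All Con bs) → 𝒮⟦ cons cs ⟧ˢ [] ≡ η (All.map ⟦_⟧ᶜ cs)
  𝒮-cons []       = refl
  𝒮-cons (c ∷ cs) = trans (>>=-identityˡ ⟦ c ⟧ᶜ λ a → 𝒮⟦ cons cs ⟧ˢ [] >>= λ as → η (a ∷ as))
                          (>>=-η (𝒮-cons cs) λ as → η (⟦ c ⟧ᶜ ∷ as))

  𝒮-single : ∀ {σ τ} (M : Tm (σ ∷ []) τ) (V : Val σ) →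
             𝒮⟦ M [ ⌜ V ⌝ ] ⟧ [] ≡ 𝒮⟦ M ⟧ (𝒮ₚ⟦ V ⟧ ∷ [])
  𝒮-single M V = 𝒮-sub _ _ _ (λ { (here refl) → 𝒮-val V }) M

  𝒮-↝ : ∀ {σ} {Q Q′ : Prog σ} → Q ↝ Q′ → 𝒮⟦ Q ⟧ [] ≡ 𝒮⟦ Q′ ⟧ []
  𝒮-↝ (fn f cs) = trans (>>=-η (𝒮-cons cs) λ as → η (⟦ f ⟧ᶠ as)) (cong η (⟦valᶠ⟧ f cs))
  𝒮-↝ (ifᵗ {M = M} {N}) =
    trans (>>=-identityˡ ⟦ ttᶜ ⟧ᶜ (λ t → if t then 𝒮⟦ M ⟧ [] else 𝒮⟦ N ⟧ []))
          (cong (λ t → if t then 𝒮⟦ M ⟧ [] else 𝒮⟦ N ⟧ []) ⟦ttᶜ⟧)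
  𝒮-↝ (ifᶠ {M = M} {N}) =
    trans (>>=-identityˡ ⟦ ffᶜ ⟧ᶜ (λ t → if t then 𝒮⟦ M ⟧ [] else 𝒮⟦ N ⟧ []))
          (cong (λ t → if t then 𝒮⟦ M ⟧ [] else 𝒮⟦ N ⟧ []) ⟦ffᶜ⟧)
  𝒮-↝ (fst V W) = trans (>>=-η (𝒮-val (pair V W)) λ p → η (proj₁ p)) (sym (𝒮-val V))
  𝒮-↝ (snd V W) = trans (>>=-η (𝒮-val (pair V W)) λ p → η (proj₂ p)) (sym (𝒮-val W))
  𝒮-↝ (beta M V) =
    trans (>>=-identityˡ (λ a → 𝒮⟦ M ⟧ (a ∷ [])) λ h → 𝒮⟦ ⌜ V ⌝ ⟧ [] >>= λ a → h a)
          (trans (>>=-η (𝒮-val V) λ a → 𝒮⟦ M ⟧ (a ∷ [])) (sym (𝒮-single M V)))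

  -- Whatever stands to the left of the hole is already a value, so it enters through its pure
  -- denotation instead of being sequenced.
  𝒦⟦_⟧  : ∀ {ρ σ} → ECtx ρ σ → 𝒮ᵗ ρ → S (𝒮ᵗ σ)
  𝒦⟦_⟧ˢ : ∀ {ρ bs} → ECtxs ρ bs → 𝒮ᵗ ρ → S (All ⟦_⟧ᵇ bs)
  𝒦⟦ □ ⟧ q          = η q
  𝒦⟦ fn f C ⟧ q     = 𝒦⟦ C ⟧ˢ q >>= λ as → η (⟦ f ⟧ᶠ as)
  𝒦⟦ cond C M N ⟧ q = 𝒦⟦ C ⟧ q >>= λ t → if t then 𝒮⟦ M ⟧ [] else 𝒮⟦ N ⟧ []
  𝒦⟦ C · M ⟧ q      = 𝒦⟦ C ⟧ q >>= λ r → r ·ₛ 𝒮⟦ M ⟧ []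
  𝒦⟦ pairˡ C N ⟧ q  = 𝒦⟦ C ⟧ q >>= λ a → 𝒮⟦ N ⟧ [] >>= λ b → η (a , b)
  𝒦⟦ pairʳ V C ⟧ q  = 𝒦⟦ C ⟧ q >>= λ b → η (𝒮ₚ⟦ V ⟧ , b)
  𝒦⟦ fst C ⟧ q      = 𝒦⟦ C ⟧ q >>= λ p → η (proj₁ p)
  𝒦⟦ snd C ⟧ q      = 𝒦⟦ C ⟧ q >>= λ p → η (proj₂ p)
  𝒦⟦ appˡ C N ⟧ q   = 𝒦⟦ C ⟧ q >>= λ h → 𝒮⟦ N ⟧ [] >>= λ a → h a
  𝒦⟦ appʳ M C ⟧ q   = 𝒦⟦ C ⟧ q >>= λ a → 𝒮⟦ M ⟧ (a ∷ [])
  𝒦⟦ here C Ms ⟧ˢ q = 𝒦⟦ C ⟧ q >>= λ a → 𝒮⟦ Ms ⟧ˢ [] >>= λ as → η (a ∷ as)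
  𝒦⟦ there c C ⟧ˢ q = 𝒦⟦ C ⟧ˢ q >>= λ as → η (⟦ c ⟧ᶜ ∷ as)

  𝒮-plug  : ∀ {ρ σ} (C : ECtx ρ σ) Q → 𝒮⟦ plug C Q ⟧ [] ≡ (𝒮⟦ Q ⟧ [] >>= 𝒦⟦ C ⟧)
  𝒮-plugs : ∀ {ρ bs} (C : ECtxs ρ bs) Q → 𝒮⟦ plugs C Q ⟧ˢ [] ≡ (𝒮⟦ Q ⟧ [] >>= 𝒦⟦ C ⟧ˢ)
  -- Each frame around the hole is a continuation `f` run after the inner context; associativity
  -- absorbs it, once for all frames.
  𝒮-plug->>= : ∀ {ρ σ Y} (C : ECtx ρ σ) Q (f : 𝒮ᵗ σ → S Y) →
    (𝒮⟦ plug C Q ⟧ [] >>= f) ≡ (𝒮⟦ Q ⟧ [] >>= λ q → 𝒦⟦ C ⟧ q >>= f)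
  𝒮-plugs->>= : ∀ {ρ bs Y} (C : ECtxs ρ bs) Q (f : All ⟦_⟧ᵇ bs → S Y) →
    (𝒮⟦ plugs C Q ⟧ˢ [] >>= f) ≡ (𝒮⟦ Q ⟧ [] >>= λ q → 𝒦⟦ C ⟧ˢ q >>= f)
  𝒮-plug □ Q            = sym (>>=-identityʳ _)
  𝒮-plug (fn f C) Q     = 𝒮-plugs->>= C Q λ as → η (⟦ f ⟧ᶠ as)
  𝒮-plug (cond C M N) Q = 𝒮-plug->>= C Q λ t → if t then 𝒮⟦ M ⟧ [] else 𝒮⟦ N ⟧ []
  𝒮-plug (C · M) Q      = 𝒮-plug->>= C Q λ r → r ·ₛ 𝒮⟦ M ⟧ []
  𝒮-plug (pairˡ C N) Q  = 𝒮-plug->>= C Q λ a → 𝒮⟦ N ⟧ [] >>= λ b → η (a , b)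
  𝒮-plug (pairʳ V C) Q  =
    -- Left identity removes the sequencing of the evaluated component, which gives the form used by
    -- `𝒦⟦_⟧`.
    trans (>>=-η (𝒮-val V) λ a → 𝒮⟦ plug C Q ⟧ [] >>= λ b → η (a , b))
          (𝒮-plug->>= C Q λ b → η (𝒮ₚ⟦ V ⟧ , b))
  𝒮-plug (fst C) Q      = 𝒮-plug->>= C Q λ p → η (proj₁ p)
  𝒮-plug (snd C) Q      = 𝒮-plug->>= C Q λ p → η (proj₂ p)
  𝒮-plug (appˡ C N) Q   = 𝒮-plug->>= C Q λ h → 𝒮⟦ N ⟧ [] >>= λ a → h a
  𝒮-plug (appʳ M C) Q   =
    trans (>>=-identityˡ (λ a → 𝒮⟦ M ⟧ (a ∷ [])) λ h → 𝒮⟦ plug C Q ⟧ [] >>= λ a → h a)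
          (𝒮-plug->>= C Q λ a → 𝒮⟦ M ⟧ (a ∷ []))
  𝒮-plugs (here C Ms) Q =
    𝒮-plug->>= C Q λ a → 𝒮⟦ Ms ⟧ˢ [] >>= λ as → η (a ∷ as)
  𝒮-plugs (there c C) Q =
    trans (>>=-identityˡ ⟦ c ⟧ᶜ λ a → 𝒮⟦ plugs C Q ⟧ˢ [] >>= λ as → η (a ∷ as))
          (𝒮-plugs->>= C Q λ as → η (⟦ c ⟧ᶜ ∷ as))
  𝒮-plug->>= C Q f      =
    trans (>>=-congˡ f (𝒮-plug C Q)) (>>=-assoc (𝒮⟦ Q ⟧ []) 𝒦⟦ C ⟧ f)
  𝒮-plugs->>= C Q f     =
    trans (>>=-congˡ f (𝒮-plugs C Q)) (>>=-assoc (𝒮⟦ Q ⟧ []) 𝒦⟦ C ⟧ˢ f)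

  -- Effect values and soundness of evaluation.

  𝒮ₑ⟦_⟧ : ∀ {σ} → Eff σ → S (𝒮ᵗ σ)
  𝒮ₑ⟦ val V ⟧    = η 𝒮ₚ⟦ V ⟧
  𝒮ₑ⟦ E₁ or E₂ ⟧ = 𝒮ₑ⟦ E₁ ⟧ orₛ 𝒮ₑ⟦ E₂ ⟧
  𝒮ₑ⟦ c · E ⟧    = ⟦ c ⟧ᶜ ·ₛ 𝒮ₑ⟦ E ⟧

  𝒮-⇓ : ∀ {σ} {M : Prog σ} {E} → M ⇓ E → 𝒮⟦ M ⟧ [] ≡ 𝒮ₑ⟦ E ⟧
  𝒮-⇓ (value V) = 𝒮-val V
  𝒮-⇓ (reduce (step C {Q} {Q′} s) d) =
    trans (𝒮-plug C Q)
      (trans (>>=-congˡ 𝒦⟦ C ⟧ (𝒮-↝ s)) (trans (sym (𝒮-plug C Q′)) (𝒮-⇓ d)))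
  𝒮-⇓ (choose C {M₁} {M₂} d₁ d₂) =
    trans (𝒮-plug C (M₁ or M₂))
      (trans (orₛ->>= (𝒮⟦ M₁ ⟧ []) (𝒮⟦ M₂ ⟧ []) 𝒦⟦ C ⟧)
        (cong₂ _orₛ_ (trans (sym (𝒮-plug C M₁)) (𝒮-⇓ d₁))
                     (trans (sym (𝒮-plug C M₂)) (𝒮-⇓ d₂))))
  𝒮-⇓ (reward C c {M} d) =
    trans (𝒮-plug C (con c · M))
      -- The reward is a constant, hence pure: left identity exposes `·ₛ`, past which the context
      -- can then be moved.
      (trans (>>=-congˡ 𝒦⟦ C ⟧ (>>=-identityˡ ⟦ c ⟧ᶜ (λ r → r ·ₛ 𝒮⟦ M ⟧ [])))
        (trans (·ₛ->>= ⟦ c ⟧ᶜ (𝒮⟦ M ⟧ []) 𝒦⟦ C ⟧)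
          (cong (⟦ c ⟧ᶜ ·ₛ_) (trans (sym (𝒮-plug C M)) (𝒮-⇓ d)))))

  -- Optimal strategies at the zero reward function.

  OrderEquivalent : {A : Set} → (A → R) → (A → R) → Set
  OrderEquivalent f g = ∀ s t → f s ≤ f t ⇔ g s ≤ g t

  -- The axioms on rewards translate on the right, whereas `Out` adds `⟦ c ⟧ᶜ` on the left;
  -- commutativity bridges the two.
  +-order : ∀ {t r s} → t + r ≤ t + s ⇔ r ≤ s
  +-order {t} {r} {s} = mk⇔
    (λ p → +-cancel-≤ t (subst₂ _≤_ (comm t r) (comm t s) p))
    (λ p → subst₂ _≤_ (comm r t) (comm s t) (+-mono-≤ t p))

  -- Reduces the test made by `orₛ` to a comparison of accumulated rewards.
  𝐑-zero : ∀ {X : Set} (F : S X) → 𝐑 F (λ _ → 0#) ≡ proj₁ (F (λ _ → 0#))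
  𝐑-zero F = identityʳ _

  -- Stated for objectives that merely order strategies as their rewards do,
  -- because on c · E the objective is translated by ⟦ c ⟧ᶜ.
  argmax-adequate : ∀ {σ} (E : Eff σ) (f : Str E → R) → OrderEquivalent f (Reward E) →
                    map₂ 𝒮ₚ⟦_⟧ (Out E (argmax E f)) ≡ 𝒮ₑ⟦ E ⟧ (λ _ → 0#)
  argmax-adequate (val V) f f∼ = refl
  argmax-adequate (c · E) f f∼ =
    cong (λ { (r , a) → ⟦ c ⟧ᶜ + r , a })
      (argmax-adequate E f λ s t → mk⇔
        (Equivalence.to +-order ∘ Equivalence.to (f∼ s t))
        (Equivalence.from (f∼ s t) ∘ Equivalence.from +-order))
  argmax-adequate (E₁ or E₂) f f∼
    -- The induction hypotheses are used from right to left, so that the semantic choice compares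
    -- the rewards of the argmax strategies of `E₁` and `E₂`.
    rewrite 𝐑-zero 𝒮ₑ⟦ E₁ ⟧ | 𝐑-zero 𝒮ₑ⟦ E₂ ⟧
          | sym (argmax-adequate E₁ (f ∘ inj₁) (λ s t → f∼ (inj₁ s) (inj₁ t)))
          | sym (argmax-adequate E₂ (f ∘ inj₂) (λ s t → f∼ (inj₂ s) (inj₂ t)))
    with findArgmax E₁ (f ∘ inj₁) | findArgmax E₂ (f ∘ inj₂)
  ... | s₁ , _ | s₂ , _
    -- `findArgmax` tests the objective and `orₛ` tests the reward, both keeping the left side on
    -- ties; order equivalence excludes differing answers.
    with f (inj₂ s₂) ≤? f (inj₁ s₁) | Reward E₂ s₂ ≤? Reward E₁ s₁
  ... | yes p | yes q = refl
  ... | yes p | no ¬q = contradiction (Equivalence.to (f∼ (inj₂ s₂) (inj₁ s₁)) p) ¬q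
  ... | no ¬p | yes q = contradiction (Equivalence.from (f∼ (inj₂ s₂) (inj₁ s₁)) q) ¬p
  ... | no ¬p | no ¬q = refl

  Opₛ-adequate : ∀ {σ} (M : Prog σ) → map₂ 𝒮ₚ⟦_⟧ (Opₛ M) ≡ 𝒮⟦ M ⟧ [] (λ _ → 0#)
  Opₛ-adequate M =
    trans (argmax-adequate (Op M) (Reward (Op M)) (λ s t → mk⇔ (λ p → p) (λ p → p)))
          (cong (λ F → F (λ _ → 0#)) (sym (𝒮-⇓ (Op-⇓ M))))

theorem4p6 : Extensionality 0ℓ 0ℓ →
    (𝕊 : Signature) (𝓡 : Rewards) (𝓘 : Interpretation 𝕊 𝓡) →
    let open Semantics 𝕊 𝓡 𝓘 in
    ∀ {σ} (M : Prog σ) (r : R) (V : Val σ) →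
    Opₛ M ≡ (r , V) →
    𝒮⟦ M ⟧ [] (λ _ → 0#) ≡ (r , 𝒮ₚ⟦ V ⟧)
theorem4p6 funext 𝕊 𝓡 𝓘 M r V eq =
  trans (sym (Opₛ-adequate M)) (cong (map₂ 𝒮ₚ⟦_⟧) eq)
  where
  open Semantics 𝕊 𝓡 𝓘
  open Adequacy funext 𝕊 𝓡 𝓘
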